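{- Let $M$ be a finite simple connected graph whose path matrix has exactly one positive eigenvalue (counted with multiplicity). Then this positive path eigenvalue is the path spectral radius $\rho$ of $M$, and the path energy of $M$ is $PE(M)=2\rho$.
   Context: For a finite simple graph $M$ with vertex set $\{v_1,\dots,v_p\}$, the path matrix $P(M)=(p_{i,j})$ is the $p\times p$ real symmetric matrix with $p_{i,i}=0$ and, for $i\neq j$, $p_{i,j}$ equal to the maximum number of vertex disjoint paths from $v_i$ to $v_j$ (i.e. paths that pairwise share no vertices other than the endpoints $v_i,v_j$; an edge $v_iv_j$ counts as one such path). The path eigenvalues of $M$ are the eigenvalues of $P(M)$; the path spectral radius $\rho$ is the maximum of the absolute values of the path eigenvalues; and the path energy $PE(M)$ is the sum of the absolute values of the path eigenvalues, counted with multiplicity. -}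

module Defs where

open import Level using (0ℓ)
open import Algebra.Bundles using (RawRing)
import Algebra.Definitions.RawSemiring as RawSemiringDefs
open import Data.Fin.Base using (Fin; zero; suc; toℕ; punchIn)
open import Data.Fin.Properties using (_≟_; injective⇒≤)
open import Data.Integer.Base using (+_)
open import Data.List.Base
  using (List; []; _∷_; _∷ʳ_; length; map; upTo; allFin; concatMap; cartesianProductWith; lookup)
open import Data.List.Membership.Propositional using (_∈_; find; lose)
open import Data.List.Membership.Propositional.Properties
  using (∈-allFin; ∈-upTo⁺; ∈-concatMap⁺; ∈-cartesianProductWith⁺; ∈-++⁺ʳ; ∈-lookup)
import Data.List.Relation.Binary.Disjoint.DecPropositional as DecDisjoint
open import Data.List.Properties using (≡-dec; length-++; length-map)
open import Data.List.Relation.Binary.Disjoint.Propositional using (Disjoint)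
open import Data.List.Relation.Unary.All as All using (All; []; _∷_)
import Data.List.Relation.Unary.All.Properties as Allₚ
open import Data.List.Relation.Unary.AllPairs using (AllPairs; []; _∷_; allPairs?)
open import Data.List.Relation.Unary.Any using (here; any?)
open import Data.List.Relation.Unary.Linked as Linked using (Linked)
open import Data.List.Relation.Unary.Unique.Propositional using (Unique)
open import Data.List.Relation.Unary.Unique.DecPropositional using (unique?)
open import Data.Nat.Base as ℕ using (ℕ; zero; suc)
import Data.Nat.Properties as ℕₚ
open import Data.Product using (∃; ∃-syntax; _×_; _,_; proj₁; proj₂)
open import Data.Rational.Base as ℚ using (ℚ; 0ℚ; 1ℚ; ½)
import Data.Rational.Properties as ℚₚ
import Data.Rational.Solver as ℚSolver
open import Data.Sum.Base using (inj₁; inj₂)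
import Data.Vec.Functional as Vector
open import Function.Base using (_∘_)
open import Relation.Binary.Construct.Closure.ReflexiveTransitive using (Star)
open import Relation.Binary.Core using (Rel)
open import Relation.Binary.Definitions using (Decidable; Symmetric; Irreflexive)
open import Relation.Binary.PropositionalEquality
  using (_≡_; _≢_; refl; sym; trans; cong; cong₂; subst)
open import Relation.Nullary.Decidable using (Dec; yes; no; _×-dec_; map′; ¬?)
open import Relation.Nullary.Negation using (contradiction)
open import Relation.Unary as Unary using (Pred)

------------------------------------------------------------------------
-- Real numbers: Cauchy sequences of rationals, up to _≈_

Eventually : Pred ℕ 0ℓ → Set
Eventually P = ∃[ N ] ∀ n → N ℕ.≤ n → P n

IsCauchy : (ℕ → ℚ) → Set
IsCauchy s = ∀ ε → 0ℚ ℚ.< ε →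
  ∃[ N ] ∀ m n → N ℕ.≤ m → N ℕ.≤ n → ℚ.∣ s m ℚ.- s n ∣ ℚ.< ε

record ℝ : Set where
  constructor mkℝ
  field
    seq    : ℕ → ℚ
    cauchy : IsCauchy seq

open ℝ public

infix 4 _≈_ _<_

_≈_ : Rel ℝ 0ℓ
x ≈ y = ∀ ε → 0ℚ ℚ.< ε → Eventually λ n → ℚ.∣ seq x n ℚ.- seq y n ∣ ℚ.< ε

-- A strict inequality between limits needs a uniform gap between the sequences.
_<_ : Rel ℝ 0ℓ
x < y = ∃[ ε ] 0ℚ ℚ.< ε × Eventually λ n → seq x n ℚ.+ ε ℚ.≤ seq y n

module Estimates where
  open ℚSolver.+-*-Solver using (solve; _:=_; _:+_; _:*_; _:-_; :-_; con)
  open ℚₚ.≤-Reasoning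

  dist : ℚ → ℚ → ℚ
  dist a b = ℚ.∣ a ℚ.- b ∣

  ∣∣-lub : ∀ {p q} → p ℚ.≤ q → ℚ.- p ℚ.≤ q → ℚ.∣ p ∣ ℚ.≤ q
  ∣∣-lub {p} p≤q -p≤q with ℚₚ.∣p∣≡p∨∣p∣≡-p p
  ... | inj₁ eq = subst (ℚ._≤ _) (sym eq) p≤q
  ... | inj₂ eq = subst (ℚ._≤ _) (sym eq) -p≤q

  p≤∣p∣ : ∀ p → p ℚ.≤ ℚ.∣ p ∣
  p≤∣p∣ p with ℚₚ.≤-total 0ℚ p
  ... | inj₁ 0≤p = ℚₚ.≤-reflexive (sym (ℚₚ.0≤p⇒∣p∣≡p 0≤p))
  ... | inj₂ p≤0 = ℚₚ.≤-trans p≤0 (ℚₚ.0≤∣p∣ p)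

  -≤ : ∀ {a b c} → a ℚ.≤ b ℚ.+ c → a ℚ.- b ℚ.≤ c
  -≤ {a} {b} {c} a≤b+c = begin
    a ℚ.- b            ≤⟨ ℚₚ.+-monoˡ-≤ (ℚ.- b) a≤b+c ⟩
    (b ℚ.+ c) ℚ.- b    ≡⟨ solve 2 (λ b c → (b :+ c) :- b := c) refl b c ⟩
    c                  ∎

  dist-sym : ∀ a b → dist a b ≡ dist b a
  dist-sym a b = trans (sym (ℚₚ.∣-p∣≡∣p∣ (a ℚ.- b)))
    (cong ℚ.∣_∣ (solve 2 (λ a b → :- (a :- b) := b :- a) refl a b))

  dist-lub : ∀ {a b c} → a ℚ.≤ b ℚ.+ c → b ℚ.≤ a ℚ.+ c → dist a b ℚ.≤ c
  dist-lub {a} {b} {c} p q = ∣∣-lub (-≤ p)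
    (subst (ℚ._≤ c) (solve 2 (λ a b → b :- a := :- (a :- b)) refl a b) (-≤ q))

  ≤+dist : ∀ a b → a ℚ.≤ b ℚ.+ dist a b
  ≤+dist a b = begin
    a                  ≡⟨ solve 2 (λ a b → a := b :+ (a :- b)) refl a b ⟩
    b ℚ.+ (a ℚ.- b)    ≤⟨ ℚₚ.+-monoʳ-≤ b (p≤∣p∣ (a ℚ.- b)) ⟩
    b ℚ.+ dist a b     ∎

  ∣∣≤∣∣+dist : ∀ a b → ℚ.∣ a ∣ ℚ.≤ ℚ.∣ b ∣ ℚ.+ dist a b
  ∣∣≤∣∣+dist a b = begin
    ℚ.∣ a ∣                    ≡⟨ cong ℚ.∣_∣ (solve 2 (λ a b → a := b :+ (a :- b)) refl a b) ⟩
    ℚ.∣ b ℚ.+ (a ℚ.- b) ∣      ≤⟨ ℚₚ.∣p+q∣≤∣p∣+∣q∣ b (a ℚ.- b) ⟩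
    ℚ.∣ b ∣ ℚ.+ dist a b       ∎

  dist-∣∣ : ∀ a b → dist ℚ.∣ a ∣ ℚ.∣ b ∣ ℚ.≤ dist a b
  dist-∣∣ a b = dist-lub (∣∣≤∣∣+dist a b)
    (subst (λ d → ℚ.∣ b ∣ ℚ.≤ ℚ.∣ a ∣ ℚ.+ d) (dist-sym b a) (∣∣≤∣∣+dist b a))

  dist-neg : ∀ a b → dist (ℚ.- a) (ℚ.- b) ℚ.≤ dist a b
  dist-neg a b = ℚₚ.≤-reflexive (trans
    (cong ℚ.∣_∣ (solve 2 (λ a b → (:- a) :- (:- b) := b :- a) refl a b)) (dist-sym b a))

  dist-+ : ∀ a b c d → dist (a ℚ.+ b) (c ℚ.+ d) ℚ.≤ dist a c ℚ.+ dist b d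
  dist-+ a b c d = begin
    dist (a ℚ.+ b) (c ℚ.+ d)
      ≡⟨ cong ℚ.∣_∣ (solve 4 (λ a b c d → (a :+ b) :- (c :+ d) := (a :- c) :+ (b :- d)) refl a b c d) ⟩
    ℚ.∣ (a ℚ.- c) ℚ.+ (b ℚ.- d) ∣
      ≤⟨ ℚₚ.∣p+q∣≤∣p∣+∣q∣ (a ℚ.- c) (b ℚ.- d) ⟩
    dist a c ℚ.+ dist b d ∎

  ⊔≤⊔+dist : ∀ a b c d → a ℚ.⊔ b ℚ.≤ (c ℚ.⊔ d) ℚ.+ (dist a c ℚ.+ dist b d)
  ⊔≤⊔+dist a b c d = ℚₚ.⊔-lub
    (ℚₚ.≤-trans (≤+dist a c) (ℚₚ.+-mono-≤ (ℚₚ.p≤p⊔q c d)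
      (subst (ℚ._≤ dist a c ℚ.+ dist b d) (ℚₚ.+-identityʳ _)
        (ℚₚ.+-monoʳ-≤ (dist a c) (ℚₚ.0≤∣p∣ (b ℚ.- d))))))
    (ℚₚ.≤-trans (≤+dist b d) (ℚₚ.+-mono-≤ (ℚₚ.p≤q⊔p c d)
      (subst (ℚ._≤ dist a c ℚ.+ dist b d) (ℚₚ.+-identityˡ _)
        (ℚₚ.+-monoˡ-≤ (dist b d) (ℚₚ.0≤∣p∣ (a ℚ.- c))))))

  dist-⊔ : ∀ a b c d → dist (a ℚ.⊔ b) (c ℚ.⊔ d) ℚ.≤ dist a c ℚ.+ dist b d
  dist-⊔ a b c d = dist-lub (⊔≤⊔+dist a b c d)
    (subst (λ e → c ℚ.⊔ d ℚ.≤ (a ℚ.⊔ b) ℚ.+ e)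
      (cong₂ ℚ._+_ (dist-sym c a) (dist-sym d b)) (⊔≤⊔+dist c d a b))

  dist-* : ∀ {B} a b c d → ℚ.∣ a ∣ ℚ.≤ B → ℚ.∣ d ∣ ℚ.≤ B →
           dist (a ℚ.* b) (c ℚ.* d) ℚ.≤ B ℚ.* (dist a c ℚ.+ dist b d)
  dist-* {B} a b c d ∣a∣≤B ∣d∣≤B = begin
    dist (a ℚ.* b) (c ℚ.* d)
      ≡⟨ cong ℚ.∣_∣ (solve 4 (λ a b c d → a :* b :- c :* d := d :* (a :- c) :+ a :* (b :- d)) refl a b c d) ⟩
    ℚ.∣ d ℚ.* (a ℚ.- c) ℚ.+ a ℚ.* (b ℚ.- d) ∣
      ≤⟨ ℚₚ.∣p+q∣≤∣p∣+∣q∣ (d ℚ.* (a ℚ.- c)) (a ℚ.* (b ℚ.- d)) ⟩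
    ℚ.∣ d ℚ.* (a ℚ.- c) ∣ ℚ.+ ℚ.∣ a ℚ.* (b ℚ.- d) ∣
      ≡⟨ cong₂ ℚ._+_ (ℚₚ.∣p*q∣≡∣p∣*∣q∣ d (a ℚ.- c)) (ℚₚ.∣p*q∣≡∣p∣*∣q∣ a (b ℚ.- d)) ⟩
    ℚ.∣ d ∣ ℚ.* dist a c ℚ.+ ℚ.∣ a ∣ ℚ.* dist b d
      ≤⟨ ℚₚ.+-mono-≤ (ℚₚ.*-monoʳ-≤-nonNeg (dist a c) {{ℚₚ.∣-∣-nonNeg (a ℚ.- c)}} ∣d∣≤B)
                     (ℚₚ.*-monoʳ-≤-nonNeg (dist b d) {{ℚₚ.∣-∣-nonNeg (b ℚ.- d)}} ∣a∣≤B) ⟩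
    B ℚ.* dist a c ℚ.+ B ℚ.* dist b d
      ≡⟨ sym (ℚₚ.*-distribˡ-+ B (dist a c) (dist b d)) ⟩
    B ℚ.* (dist a c ℚ.+ dist b d) ∎

  rescale : ∀ B → 0ℚ ℚ.< B → ∀ ε → 0ℚ ℚ.< ε → ∃[ δ ] 0ℚ ℚ.< δ × B ℚ.* (δ ℚ.+ δ) ≡ ε
  rescale B 0<B ε 0<ε = δ , ℚₚ.positive⁻¹ δ , eq
    where
    instance
      B⁺ = ℚ.positive 0<B
      ε⁺ = ℚ.positive 0<ε
      B≢0 = ℚₚ.pos⇒nonZero B
      B⁻¹⁺ = ℚₚ.1/pos⇒pos B
      ½ε⁺ = ℚₚ.pos*pos⇒pos ½ ε
    δ = (½ ℚ.* ε) ℚ.* (ℚ.1/ B)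
    instance
      δ⁺ = ℚₚ.pos*pos⇒pos (½ ℚ.* ε) (ℚ.1/ B)
    eq : B ℚ.* (δ ℚ.+ δ) ≡ ε
    eq = begin-equality
      B ℚ.* (δ ℚ.+ δ)
        ≡⟨ solve 3 (λ b e i → b :* ((con ½ :* e) :* i :+ (con ½ :* e) :* i) := (b :* i) :* e)
             refl B ε (ℚ.1/ B) ⟩
      (B ℚ.* (ℚ.1/ B)) ℚ.* ε  ≡⟨ cong (ℚ._* ε) (ℚₚ.*-inverseʳ B) ⟩
      1ℚ ℚ.* ε                ≡⟨ ℚₚ.*-identityˡ ε ⟩
      ε                       ∎

  0<1 : 0ℚ ℚ.< 1ℚ
  0<1 = ℚₚ.positive⁻¹ 1ℚ

  cauchy₁ : ∀ (f : ℚ → ℚ) → (∀ a b → dist (f a) (f b) ℚ.≤ dist a b) →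
            ∀ x → IsCauchy (f ∘ seq x)
  cauchy₁ f f-lip x ε 0<ε = let N , h = cauchy x ε 0<ε in
    N , λ m n N≤m N≤n → ℚₚ.≤-<-trans (f-lip _ _) (h m n N≤m N≤n)

  cauchy₂ : ∀ (f : ℚ → ℚ → ℚ) x y K → 0ℚ ℚ.< K → ∀ M →
            (∀ m n → M ℕ.≤ m → M ℕ.≤ n →
              dist (f (seq x m) (seq y m)) (f (seq x n) (seq y n))
                ℚ.≤ K ℚ.* (dist (seq x m) (seq x n) ℚ.+ dist (seq y m) (seq y n))) →
            IsCauchy (λ n → f (seq x n) (seq y n))
  cauchy₂ f x y K 0<K M f-lip ε 0<ε =
    let δ , 0<δ , Kδ≡ε = rescale K 0<K ε 0<ε
        N₁ , h₁ = cauchy x δ 0<δ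
        N₂ , h₂ = cauchy y δ 0<δ
        N = M ℕ.⊔ (N₁ ℕ.⊔ N₂)
        M≤N  = ℕₚ.m≤m⊔n M (N₁ ℕ.⊔ N₂)
        N₁≤N = ℕₚ.≤-trans (ℕₚ.m≤m⊔n N₁ N₂) (ℕₚ.m≤n⊔m M (N₁ ℕ.⊔ N₂))
        N₂≤N = ℕₚ.≤-trans (ℕₚ.m≤n⊔m N₁ N₂) (ℕₚ.m≤n⊔m M (N₁ ℕ.⊔ N₂))
    in N , λ m n N≤m N≤n →
      ℚₚ.≤-<-trans (f-lip m n (ℕₚ.≤-trans M≤N N≤m) (ℕₚ.≤-trans M≤N N≤n))
        (subst (K ℚ.* _ ℚ.<_) Kδ≡ε
          (ℚₚ.*-monoʳ-<-pos K {{ℚ.positive 0<K}}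
            (ℚₚ.+-mono-< (h₁ m n (ℕₚ.≤-trans N₁≤N N≤m) (ℕₚ.≤-trans N₁≤N N≤n))
                         (h₂ m n (ℕₚ.≤-trans N₂≤N N≤m) (ℕₚ.≤-trans N₂≤N N≤n)))))

  nonexpanding₂ : ∀ (f : ℚ → ℚ → ℚ) →
    (∀ a b c d → dist (f a b) (f c d) ℚ.≤ dist a c ℚ.+ dist b d) →
    ∀ x y → IsCauchy (λ n → f (seq x n) (seq y n))
  nonexpanding₂ f f-lip x y = cauchy₂ f x y 1ℚ 0<1 0 λ m n _ _ →
    ℚₚ.≤-trans (f-lip _ _ _ _) (ℚₚ.≤-reflexive (sym (ℚₚ.*-identityˡ _)))

  bounded : ∀ x → ∃[ B ] 0ℚ ℚ.≤ B × Eventually λ n → ℚ.∣ seq x n ∣ ℚ.≤ B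
  bounded x = let N , h = cauchy x 1ℚ 0<1 in
    ℚ.∣ seq x N ∣ ℚ.+ 1ℚ ,
    ℚₚ.+-mono-≤ (ℚₚ.0≤∣p∣ (seq x N)) (ℚₚ.<⇒≤ 0<1) ,
    N , λ n N≤n → ℚₚ.≤-trans (∣∣≤∣∣+dist (seq x n) (seq x N))
      (ℚₚ.+-monoʳ-≤ ℚ.∣ seq x N ∣ (ℚₚ.<⇒≤ (h n N N≤n ℕₚ.≤-refl)))

  abstract
    const-cauchy : ∀ q → IsCauchy (λ _ → q)
    const-cauchy q ε 0<ε = 0 , λ _ _ _ _ →
      subst (ℚ._< ε) (sym (cong ℚ.∣_∣ (ℚₚ.+-inverseʳ q))) 0<ε

    +-cauchy : ∀ x y → IsCauchy (λ n → seq x n ℚ.+ seq y n)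
    +-cauchy = nonexpanding₂ ℚ._+_ dist-+

    ⊔-cauchy : ∀ x y → IsCauchy (λ n → seq x n ℚ.⊔ seq y n)
    ⊔-cauchy = nonexpanding₂ ℚ._⊔_ dist-⊔

    neg-cauchy : ∀ x → IsCauchy (λ n → ℚ.- seq x n)
    neg-cauchy = cauchy₁ (ℚ.-_) dist-neg

    ∣∣-cauchy : ∀ x → IsCauchy (λ n → ℚ.∣ seq x n ∣)
    ∣∣-cauchy = cauchy₁ ℚ.∣_∣ dist-∣∣

    *-cauchy : ∀ x y → IsCauchy (λ n → seq x n ℚ.* seq y n)
    *-cauchy x y =
      let B₁ , 0≤B₁ , N₁ , h₁ = bounded x
          B₂ , 0≤B₂ , N₂ , h₂ = bounded y
          B = (B₁ ℚ.+ B₂) ℚ.+ 1ℚ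
          B₁+B₂≤B : B₁ ℚ.+ B₂ ℚ.≤ B
          B₁+B₂≤B = subst (ℚ._≤ B) (ℚₚ.+-identityʳ _) (ℚₚ.+-monoʳ-≤ (B₁ ℚ.+ B₂) (ℚₚ.<⇒≤ 0<1))
          B₁≤B : B₁ ℚ.≤ B
          B₁≤B = ℚₚ.≤-trans (subst (ℚ._≤ B₁ ℚ.+ B₂) (ℚₚ.+-identityʳ _) (ℚₚ.+-monoʳ-≤ B₁ 0≤B₂)) B₁+B₂≤B
          B₂≤B : B₂ ℚ.≤ B
          B₂≤B = ℚₚ.≤-trans (subst (ℚ._≤ B₁ ℚ.+ B₂) (ℚₚ.+-identityˡ _) (ℚₚ.+-monoˡ-≤ B₂ 0≤B₁)) B₁+B₂≤B
      in cauchy₂ ℚ._*_ x y B (ℚₚ.+-mono-≤-< (ℚₚ.+-mono-≤ 0≤B₁ 0≤B₂) 0<1) (N₁ ℕ.⊔ N₂)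
        λ m n N≤m N≤n → dist-* (seq x m) (seq y m) (seq x n) (seq y n)
          (ℚₚ.≤-trans (h₁ m (ℕₚ.≤-trans (ℕₚ.m≤m⊔n N₁ N₂) N≤m)) B₁≤B)
          (ℚₚ.≤-trans (h₂ n (ℕₚ.≤-trans (ℕₚ.m≤n⊔m N₁ N₂) N≤n)) B₂≤B)

open Estimates

infixl 6 _+_ _⊔_
infixl 7 _*_
infix  8 -_

fromℚ : ℚ → ℝ
fromℚ q = mkℝ (λ _ → q) (const-cauchy q)

fromℕ : ℕ → ℝ
fromℕ n = fromℚ (+ n ℚ./ 1)

0ℝ 1ℝ : ℝ
0ℝ = fromℚ 0ℚ
1ℝ = fromℚ 1ℚ

_+_ _*_ _⊔_ : ℝ → ℝ → ℝ
x + y = mkℝ (λ n → seq x n ℚ.+ seq y n) (+-cauchy x y)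
x * y = mkℝ (λ n → seq x n ℚ.* seq y n) (*-cauchy x y)
x ⊔ y = mkℝ (λ n → seq x n ℚ.⊔ seq y n) (⊔-cauchy x y)

-_ ∣_∣ : ℝ → ℝ
- x   = mkℝ (λ n → ℚ.- seq x n) (neg-cauchy x)
∣ x ∣ = mkℝ (λ n → ℚ.∣ seq x n ∣) (∣∣-cauchy x)

ℝ-rawRing : RawRing 0ℓ 0ℓ
ℝ-rawRing = record
  { Carrier = ℝ ; _≈_ = _≈_ ; _+_ = _+_ ; _*_ = _*_ ; -_ = -_ ; 0# = 0ℝ ; 1# = 1ℝ }

------------------------------------------------------------------------
-- Polynomials and determinants

SquareMatrix : Set → ℕ → Set
SquareMatrix A n = Fin n → Fin n → A

module Polynomial (R : RawRing 0ℓ 0ℓ) where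
  private module R = RawRing R

  -- Coefficient lists, constant term first.  Trailing zeros are allowed, so
  -- equality compares coefficients rather than lists.
  Poly : Set
  Poly = List R.Carrier

  coeff : Poly → ℕ → R.Carrier
  coeff []      _       = R.0#
  coeff (a ∷ p) zero    = a
  coeff (a ∷ p) (suc k) = coeff p k

  _≈ₚ_ : Rel Poly 0ℓ
  p ≈ₚ q = ∀ k → coeff p k R.≈ coeff q k

  _+ₚ_ _*ₚ_ : Poly → Poly → Poly
  []      +ₚ q       = q
  (a ∷ p) +ₚ []      = a ∷ p
  (a ∷ p) +ₚ (b ∷ q) = (a R.+ b) ∷ (p +ₚ q)

  []      *ₚ q = []
  (a ∷ p) *ₚ q = map (a R.*_) q +ₚ (R.0# ∷ (p *ₚ q))

  const : R.Carrier → Poly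
  const a = a ∷ []

  X : Poly
  X = R.0# ∷ R.1# ∷ []

  rawRing : RawRing 0ℓ 0ℓ
  rawRing = record
    { Carrier = Poly ; _≈_ = _≈ₚ_ ; _+_ = _+ₚ_ ; _*_ = _*ₚ_ ; -_ = map (R.-_)
    ; 0# = [] ; 1# = const R.1# }

module Determinant (R : RawRing 0ℓ 0ℓ) where
  open RawRing R using (Carrier; rawSemiring; 1#) renaming (_*_ to _·_; -_ to neg)
  open RawSemiringDefs rawSemiring using (sum; _^_)

  -- Laplace expansion along the first row.
  det : ∀ {n} → SquareMatrix Carrier n → Carrier
  det {zero}  A = 1#
  det {suc n} A = sum λ j →
    (neg 1# ^ toℕ j) · (A zero j · det (λ k l → A (suc k) (punchIn j l)))

module ℝ[X] = Polynomial ℝ-rawRing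

charMatrix : ∀ {n} → SquareMatrix ℝ n → SquareMatrix ℝ[X].Poly n
charMatrix A i j with i ≟ j
... | yes _ = ℝ[X].X ℝ[X].+ₚ ℝ[X].const (- A i j)
... | no  _ = ℝ[X].const (- A i j)

charPoly : ∀ {n} → SquareMatrix ℝ n → ℝ[X].Poly
charPoly A = Determinant.det ℝ[X].rawRing (charMatrix A)

------------------------------------------------------------------------
-- Eigenvalues

-- The monic polynomial ∏ᵢ (X − λᵢ).
monicWithRoots : ∀ {n} → (Fin n → ℝ) → ℝ[X].Poly
monicWithRoots λs = product λ i → ℝ[X].X ℝ[X].+ₚ ℝ[X].const (- λs i)
  where open RawSemiringDefs (RawRing.rawSemiring ℝ[X].rawRing) using (product)

-- λs lists the n eigenvalues of A, each as often as its multiplicity as a root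
-- of det (X·I − A).  For a real symmetric matrix such a listing exists, and it
-- is unique up to order.
IsSpectrum : ∀ {n} → SquareMatrix ℝ n → (Fin n → ℝ) → Set
IsSpectrum A λs = charPoly A ℝ[X].≈ₚ monicWithRoots λs

-- Absolute values are nonnegative, so starting the maximum at 0 is harmless.
spectralRadius : ∀ {n} → (Fin n → ℝ) → ℝ
spectralRadius λs = Vector.foldr _⊔_ 0ℝ (∣_∣ ∘ λs)

energy : ∀ {n} → (Fin n → ℝ) → ℝ
energy λs = sum (∣_∣ ∘ λs)
  where open RawSemiringDefs (RawRing.rawSemiring ℝ-rawRing) using (sum)

------------------------------------------------------------------------
-- Graphs

record Graph (n : ℕ) : Set₁ where
  field
    Adj     : Rel (Fin n) 0ℓ
    adj?    : Decidable Adj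
    symm    : Symmetric Adj
    irrefl  : Irreflexive _≡_ Adj

open Graph public

Connected : ∀ {n} → Graph n → Set
Connected M = ∀ i j → Star (Adj M) i j

-- A path from i to j is represented by the list w of its interior vertices.
IsPath : ∀ {n} → Graph n → (i j : Fin n) → List (Fin n) → Set
IsPath M i j w = Linked (Adj M) (i ∷ w ∷ʳ j) × Unique (i ∷ w ∷ʳ j)

-- The edge i j has no interior vertices and hence is disjoint from itself;
-- requiring distinctness makes it count only once.
InternallyDisjoint : ∀ {n} → Rel (List (Fin n)) 0ℓ
InternallyDisjoint v w = v ≢ w × Disjoint v w

IsDisjointFamily : ∀ {n} → Graph n → (i j : Fin n) → List (List (Fin n)) → Set
IsDisjointFamily M i j ws = All (IsPath M i j) ws × AllPairs InternallyDisjoint ws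

HasDisjointPaths : ∀ {n} → Graph n → (i j : Fin n) → ℕ → Set
HasDisjointPaths M i j k = ∃[ ws ] length ws ≡ k × IsDisjointFamily M i j ws

IsMaximum : Pred ℕ 0ℓ → ℕ → Set
IsMaximum P k = P k × (∀ m → P m → m ℕ.≤ k)

module PathSearch where
  words : ∀ {A : Set} → List A → ℕ → List (List A)
  words xs zero    = [] ∷ []
  words xs (suc k) = cartesianProductWith _∷_ xs (words xs k)

  ∈-words : ∀ {A : Set} {xs ys : List A} → All (_∈ xs) ys → ys ∈ words xs (length ys)
  ∈-words []         = here refl
  ∈-words (px ∷ pxs) = ∈-cartesianProductWith⁺ _∷_ px (∈-words pxs)

  lookup-injective : ∀ {A : Set} {xs : List A} → Unique xs →
                     ∀ {i j} → lookup xs i ≡ lookup xs j → i ≡ j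
  lookup-injective (_ ∷ _)  {zero}  {zero}  _  = refl
  lookup-injective (p ∷ _)  {zero}  {suc j} eq = contradiction eq (All.lookup p (∈-lookup j))
  lookup-injective (p ∷ _)  {suc i} {zero}  eq = contradiction (sym eq) (All.lookup p (∈-lookup i))
  lookup-injective (_ ∷ ps) {suc i} {suc j} eq = cong suc (lookup-injective ps eq)

  unique⇒length≤ : ∀ {n} {xs : List (Fin n)} → Unique xs → length xs ℕ.≤ n
  unique⇒length≤ u = injective⇒≤ (lookup-injective u)

  maximum : ∀ {P : Pred ℕ 0ℓ} → Unary.Decidable P → P 0 →
            ∀ b → (∀ m → P m → m ℕ.≤ b) → ∃ (IsMaximum P)
  maximum P? P0 zero    ub = 0 , P0 , ub
  maximum P? P0 (suc b) ub with P? (suc b)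
  ... | yes Pb = suc b , Pb , ub
  ... | no ¬Pb = maximum P? P0 b λ m Pm →
    ℕₚ.≤-pred (ℕₚ.≤∧≢⇒< (ub m Pm) λ { refl → ¬Pb Pm })

  module _ {n} (M : Graph n) (i j : Fin n) where

    isPath? : Unary.Decidable (IsPath M i j)
    isPath? w = Linked.linked? (adj? M) (i ∷ w ∷ʳ j) ×-dec unique? _≟_ (i ∷ w ∷ʳ j)

    isDisjointFamily? : Unary.Decidable (IsDisjointFamily M i j)
    isDisjointFamily? ws = All.all? isPath? ws ×-dec
      allPairs? (λ v w → ¬? (≡-dec _≟_ v w) ×-dec DecDisjoint.disjoint? _≟_ v w) ws

    candidates : List (List (Fin n))
    candidates = concatMap (words (allFin n)) (upTo (suc n))

    path∈candidates : ∀ {w} → IsPath M i j w → w ∈ candidates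
    path∈candidates {w} (_ , _ ∷ u) = ∈-concatMap⁺ (words (allFin n))
      (lose (∈-upTo⁺ (ℕ.s≤s (ℕₚ.≤-trans ∣w∣≤∣w∷ʳj∣ (unique⇒length≤ u))))
            (∈-words (All.universal ∈-allFin w)))
      where
      ∣w∣≤∣w∷ʳj∣ : length w ℕ.≤ length (w ∷ʳ j)
      ∣w∣≤∣w∷ʳj∣ = subst (length w ℕ.≤_) (sym (length-++ w)) (ℕₚ.m≤m+n (length w) 1)

    hasDisjointPaths? : Unary.Decidable (HasDisjointPaths M i j)
    hasDisjointPaths? k = map′
      (λ a → let ws , _ , p = find a in ws , p)
      (λ { (ws , refl , p) → lose (∈-words (All.map path∈candidates (proj₁ p))) (refl , p) })
      (any? (λ ws → (length ws ℕₚ.≟ k) ×-dec isDisjointFamily? ws) (words candidates k))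

    -- the second vertex of a path
    next : List (Fin n) → Fin n
    next []      = j
    next (v ∷ _) = v

    next≢ : ∀ {v w} → IsPath M i j v → IsPath M i j w → InternallyDisjoint v w → next v ≢ next w
    next≢ {[]}    {[]}    _ _ (v≢w , _) _ = v≢w refl
    next≢ {[]}    {b ∷ w} _ (_ , _ ∷ b≢ ∷ _) _ eq = All.lookup b≢ (∈-++⁺ʳ w (here refl)) (sym eq)
    next≢ {a ∷ v} {[]}    (_ , _ ∷ a≢ ∷ _) _ _ eq = All.lookup a≢ (∈-++⁺ʳ v (here refl)) eq
    next≢ {a ∷ v} {b ∷ w} _ _ (_ , disj) refl = disj (here refl , here refl)

    next-unique : ∀ {ws} → IsDisjointFamily M i j ws → Unique (map next ws)
    next-unique ([] , []) = []
    next-unique (p ∷ ps , d ∷ ds) =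
      Allₚ.map⁺ (All.zipWith (λ (q , e) → next≢ p q e) (ps , d)) ∷ next-unique (ps , ds)

    hasDisjointPaths-bounded : ∀ k → HasDisjointPaths M i j k → k ℕ.≤ n
    hasDisjointPaths-bounded k (ws , refl , fam) =
      subst (ℕ._≤ n) (length-map next ws) (unique⇒length≤ (next-unique fam))

open PathSearch

abstract
  maxDisjointPaths : ∀ {n} (M : Graph n) i j → ∃ (IsMaximum (HasDisjointPaths M i j))
  maxDisjointPaths {n} M i j = maximum (hasDisjointPaths? M i j)
    ([] , refl , [] , []) n (hasDisjointPaths-bounded M i j)

pathMatrix : ∀ {n} → Graph n → SquareMatrix ℝ n
pathMatrix M i j with i ≟ j
... | yes _ = 0ℝ
... | no  _ = fromℕ (proj₁ (maxDisjointPaths M i j))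

-- The path matrix has zero diagonal, so its trace, and hence the sum of its
-- eigenvalues, vanishes.  If λᵢ is the only positive eigenvalue, it therefore
-- equals the sum of ∣λⱼ∣ over j ≠ i: it dominates every ∣λⱼ∣, and the energy is
-- 2 λᵢ.  That the eigenvalues add up to the trace is read off the coefficient of
-- Xⁿ⁻¹ in det (X·I − A) = ∏ (X − λᵢ).

module Submission where

open import Defs
open import Level using (0ℓ)
open import Algebra.Bundles using (CommutativeRing; RawRing)
import Algebra.Definitions.RawSemiring as RawSemiringDefs
import Algebra.Properties.CommutativeMonoid.Sum as Sum
open import Data.Fin.Base using (Fin; zero; suc; toℕ; punchIn; punchOut)
open import Data.Fin.Properties using (_≟_; punchInᵢ≢i; punchIn-punchOut; 0≢1+n; suc-injective)
import Data.Integer.Base as ℤ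
open import Data.List.Base using ([]; _∷_; map)
open import Data.Nat.Base as ℕ using (ℕ; zero; suc; z≤n; s≤s)
import Data.Nat.Properties as ℕₚ
open import Data.Product using (∃-syntax; _×_; _,_)
open import Data.Rational.Base as ℚ using (ℚ; 0ℚ; 1ℚ)
import Data.Rational.Properties as ℚₚ
import Data.Rational.Solver as ℚSolver
open import Data.Vec.Functional as Vector using (removeAt)
open import Function.Base using (_∘_; case_of_)
open import Relation.Binary.PropositionalEquality as ≡ using (_≡_; _≢_; subst)
import Relation.Binary.Reasoning.Setoid as SetoidReasoning
open import Relation.Nullary.Decidable using (yes; no)
open import Relation.Nullary.Negation using (¬_; contradiction)

open Estimates
open ℚSolver.+-*-Solver using (solve; _:=_; _:+_; _:*_; _:-_; :-_; con)

-- Real numbers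

zip-eventually : ∀ {P Q R : ℕ → Set} → (∀ n → P n → Q n → R n) →
                 Eventually P → Eventually Q → Eventually R
zip-eventually f (M , p) (N , q) = M ℕ.⊔ N , λ n M⊔N≤n →
  f n (p n (ℕₚ.m⊔n≤o⇒m≤o M N M⊔N≤n)) (q n (ℕₚ.m⊔n≤o⇒n≤o M N M⊔N≤n))

map-eventually : ∀ {P Q : ℕ → Set} → (∀ n → P n → Q n) → Eventually P → Eventually Q
map-eventually f (N , p) = N , λ n N≤n → f n (p n N≤n)

always : ∀ {P : ℕ → Set} → (∀ n → P n) → Eventually P
always p = 0 , λ n _ → p n

halve : ∀ ε → 0ℚ ℚ.< ε → ∃[ δ ] 0ℚ ℚ.< δ × δ ℚ.+ δ ≡ ε
halve ε 0<ε = let δ , 0<δ , eq = rescale 1ℚ 0<1 ε 0<ε in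
  δ , 0<δ , ≡.trans (≡.sym (ℚₚ.*-identityˡ _)) eq

half< : ∀ {δ} → 0ℚ ℚ.< δ → δ ℚ.< δ ℚ.+ δ
half< {δ} 0<δ = subst (ℚ._< δ ℚ.+ δ) (ℚₚ.+-identityʳ δ) (ℚₚ.+-monoʳ-< δ 0<δ)

p≤p+ε : ∀ p {ε} → 0ℚ ℚ.< ε → p ℚ.≤ p ℚ.+ ε
p≤p+ε p {ε} 0<ε = subst (ℚ._≤ p ℚ.+ ε) (ℚₚ.+-identityʳ p) (ℚₚ.+-monoʳ-≤ p (ℚₚ.<⇒≤ 0<ε))

infix 4 _≤_

-- A record, so that x and y can be inferred from a proof of x ≤ y.
record _≤_ (x y : ℝ) : Set where
  constructor mk≤
  field
    within : ∀ ε → 0ℚ ℚ.< ε → Eventually λ n → seq x n ℚ.≤ seq y n ℚ.+ ε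

open _≤_

pointwise⇒≤ : ∀ {x y} → (∀ n → seq x n ℚ.≤ seq y n) → x ≤ y
pointwise⇒≤ {y = y} x≤y = mk≤ λ ε 0<ε →
  always λ n → ℚₚ.≤-trans (x≤y n) (p≤p+ε (seq y n) 0<ε)

≤-refl : ∀ {x} → x ≤ x
≤-refl = pointwise⇒≤ λ n → ℚₚ.≤-refl

≤-trans : ∀ {x y z} → x ≤ y → y ≤ z → x ≤ z
≤-trans {x} {y} {z} x≤y y≤z = mk≤ λ ε 0<ε →
  let δ , 0<δ , δ+δ≡ε = halve ε 0<ε
  in zip-eventually
       (λ n p q → ℚₚ.≤-trans p (subst (seq y n ℚ.+ δ ℚ.≤_)
         (≡.trans (ℚₚ.+-assoc (seq z n) δ δ) (≡.cong (seq z n ℚ.+_) δ+δ≡ε))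
         (ℚₚ.+-monoˡ-≤ δ q)))
       (within x≤y δ 0<δ) (within y≤z δ 0<δ)

≤-antisym : ∀ {x y} → x ≤ y → y ≤ x → x ≈ y
≤-antisym x≤y y≤x ε 0<ε =
  -- The two inequalities only bound the distance weakly; asking for half of `ε` makes the final
  -- bound strict.
  let δ , 0<δ , δ+δ≡ε = halve ε 0<ε
  in zip-eventually
       (λ n p q → subst (_ ℚ.<_) δ+δ≡ε (ℚₚ.≤-<-trans (dist-lub p q) (half< 0<δ)))
       (within x≤y δ 0<δ) (within y≤x δ 0<δ)

≈-sym : ∀ {x y} → x ≈ y → y ≈ x
≈-sym {x} {y} x≈y ε 0<ε =
  map-eventually (λ n → subst (ℚ._< ε) (dist-sym (seq x n) (seq y n))) (x≈y ε 0<ε)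

≈⇒≤ : ∀ {x y} → x ≈ y → x ≤ y
≈⇒≤ {x} {y} x≈y = mk≤ λ ε 0<ε → map-eventually
  (λ n d<ε → ℚₚ.≤-trans (≤+dist (seq x n) (seq y n)) (ℚₚ.+-monoʳ-≤ (seq y n) (ℚₚ.<⇒≤ d<ε)))
  (x≈y ε 0<ε)

≈⇒≥ : ∀ {x y} → x ≈ y → y ≤ x
≈⇒≥ {x} {y} x≈y = ≈⇒≤ (≈-sym {x} {y} x≈y)

-- Passing through the order reuses the splitting of `ε` done in `≤-trans`.
≈-trans : ∀ {x y z} → x ≈ y → y ≈ z → x ≈ z
≈-trans {x} {y} {z} x≈y y≈z = ≤-antisym
  (≤-trans (≈⇒≤ {x} {y} x≈y) (≈⇒≤ {y} {z} y≈z))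
  (≤-trans (≈⇒≥ {y} {z} y≈z) (≈⇒≥ {x} {y} x≈y))

-- This is how identities of rationals, applied at each index, become identities of reals.
≗⇒≈ : ∀ x y → (∀ n → seq x n ≡ seq y n) → x ≈ y
≗⇒≈ x y x≗y = ≤-antisym (pointwise⇒≤ {x} {y} (ℚₚ.≤-reflexive ∘ x≗y))
                        (pointwise⇒≤ {y} {x} (ℚₚ.≤-reflexive ∘ ≡.sym ∘ x≗y))

+-mono-≤ : ∀ {x y u v} → x ≤ y → u ≤ v → x + u ≤ y + v
+-mono-≤ {x} {y} {u} {v} x≤y u≤v = mk≤ λ ε 0<ε →
  let δ , 0<δ , δ+δ≡ε = halve ε 0<ε
  in zip-eventually
       (λ n p q → subst (seq x n ℚ.+ seq u n ℚ.≤_)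
         (≡.trans (solve 3 (λ a b d → (a :+ d) :+ (b :+ d) := (a :+ b) :+ (d :+ d)) ≡.refl
                     (seq y n) (seq v n) δ)
                  (≡.cong ((seq y n ℚ.+ seq v n) ℚ.+_) δ+δ≡ε))
         (ℚₚ.+-mono-≤ p q))
       (within x≤y δ 0<δ) (within u≤v δ 0<δ)

+-cong : ∀ {x y u v} → x ≈ y → u ≈ v → x + u ≈ y + v
+-cong {x} {y} {u} {v} x≈y u≈v = ≤-antisym
  (+-mono-≤ (≈⇒≤ {x} {y} x≈y) (≈⇒≤ {u} {v} u≈v))
  (+-mono-≤ (≈⇒≥ {x} {y} x≈y) (≈⇒≥ {u} {v} u≈v))

neg-cong : ∀ {x y} → x ≈ y → - x ≈ - y
neg-cong {x} {y} x≈y ε 0<ε =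
  map-eventually (λ n → ℚₚ.≤-<-trans (dist-neg (seq x n) (seq y n))) (x≈y ε 0<ε)

*-cong : ∀ {x y u v} → x ≈ y → u ≈ v → x * u ≈ y * v
*-cong {x} {y} {u} {v} x≈y u≈v ε 0<ε =
  let B₁ , 0≤B₁ , ∣x∣≤B₁ = bounded x
      B₂ , 0≤B₂ , ∣v∣≤B₂ = bounded v
      -- `dist-*` wants a single bound for the first factor of one product and the second factor of
      -- the other; adding `1ℚ` makes it positive, so that `rescale` can divide by it.
      B = (B₁ ℚ.⊔ B₂) ℚ.+ 1ℚ
      0<B : 0ℚ ℚ.< B
      0<B = ℚₚ.+-mono-≤-< (ℚₚ.≤-trans 0≤B₁ (ℚₚ.p≤p⊔q B₁ B₂)) 0<1
      ⊔≤B = p≤p+ε (B₁ ℚ.⊔ B₂) 0<1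
      δ , 0<δ , Bδ≡ε = rescale B 0<B ε 0<ε
      bounds = zip-eventually
        (λ n p q → ℚₚ.≤-trans p (ℚₚ.≤-trans (ℚₚ.p≤p⊔q B₁ B₂) ⊔≤B) ,
                   ℚₚ.≤-trans q (ℚₚ.≤-trans (ℚₚ.p≤q⊔p B₁ B₂) ⊔≤B))
        ∣x∣≤B₁ ∣v∣≤B₂
  in zip-eventually
       (λ n (p , q) (d , e) → ℚₚ.≤-<-trans
         (dist-* (seq x n) (seq u n) (seq y n) (seq v n) p q)
         (subst (B ℚ.* _ ℚ.<_) Bδ≡ε
           (ℚₚ.*-monoʳ-<-pos B {{ℚ.positive 0<B}} (ℚₚ.+-mono-< d e))))
       bounds (zip-eventually (λ n → _,_) (x≈y δ 0<δ) (u≈v δ 0<δ))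

-- The operations act termwise, so the equational laws come from ℚ index by index. The underlying
-- raw ring is `ℝ-rawRing` by definition, so results on arbitrary commutative rings apply directly
-- to `charPoly`.
ℝ-commutativeRing : CommutativeRing 0ℓ 0ℓ
ℝ-commutativeRing = record
  { Carrier = ℝ ; _≈_ = _≈_ ; _+_ = _+_ ; _*_ = _*_ ; -_ = -_ ; 0# = 0ℝ ; 1# = 1ℝ
  ; isCommutativeRing = record
    { isRing = record
      { +-isAbelianGroup = record
        { isGroup = record
          { isMonoid = record
            { isSemigroup = record
              { isMagma = record
                { isEquivalence = record
                  { refl  = λ {x} → ≗⇒≈ x x λ _ → ≡.refl
                  ; sym   = λ {x} {y} → ≈-sym {x} {y}
                  ; trans = λ {x} {y} {z} → ≈-trans {x} {y} {z}
                  }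
                ; ∙-cong = λ {x} {y} {u} {v} → +-cong {x} {y} {u} {v}
                }
              ; assoc = λ x y z → ≗⇒≈ ((x + y) + z) (x + (y + z)) λ n →
                  ℚₚ.+-assoc (seq x n) (seq y n) (seq z n)
              }
            ; identity = (λ x → ≗⇒≈ (0ℝ + x) x λ n → ℚₚ.+-identityˡ (seq x n))
                       , (λ x → ≗⇒≈ (x + 0ℝ) x λ n → ℚₚ.+-identityʳ (seq x n))
            }
          ; inverse = (λ x → ≗⇒≈ (- x + x) 0ℝ λ n → ℚₚ.+-inverseˡ (seq x n))
                    , (λ x → ≗⇒≈ (x + - x) 0ℝ λ n → ℚₚ.+-inverseʳ (seq x n))
          ; ⁻¹-cong = λ {x} {y} → neg-cong {x} {y}
          }
        ; comm = λ x y → ≗⇒≈ (x + y) (y + x) λ n → ℚₚ.+-comm (seq x n) (seq y n)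
        }
      ; *-cong = λ {x} {y} {u} {v} → *-cong {x} {y} {u} {v}
      ; *-assoc = λ x y z → ≗⇒≈ ((x * y) * z) (x * (y * z)) λ n →
          ℚₚ.*-assoc (seq x n) (seq y n) (seq z n)
      ; *-identity = (λ x → ≗⇒≈ (1ℝ * x) x λ n → ℚₚ.*-identityˡ (seq x n))
                   , (λ x → ≗⇒≈ (x * 1ℝ) x λ n → ℚₚ.*-identityʳ (seq x n))
      ; distrib = (λ x y z → ≗⇒≈ (x * (y + z)) (x * y + x * z) λ n →
                    ℚₚ.*-distribˡ-+ (seq x n) (seq y n) (seq z n))
                , (λ x y z → ≗⇒≈ ((y + z) * x) (y * x + z * x) λ n →
                    ℚₚ.*-distribʳ-+ (seq x n) (seq y n) (seq z n))
      }
    ; *-comm = λ x y → ≗⇒≈ (x * y) (y * x) λ n → ℚₚ.*-comm (seq x n) (seq y n)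
    }
  }

private module ℝ-ring = CommutativeRing ℝ-commutativeRing

-- Signs, absolute values and maxima of reals

<⇒≤ : ∀ {x y} → x < y → x ≤ y
<⇒≤ {x} {y} (γ , 0<γ , gap) = mk≤ λ ε 0<ε → map-eventually
  (λ n x+γ≤y → ℚₚ.≤-trans (p≤p+ε (seq x n) 0<γ) (ℚₚ.≤-trans x+γ≤y (p≤p+ε (seq y n) 0<ε)))
  gap

-- Of the margin `η + η` at one index, the Cauchy drift to a later index costs at most `η`; the rest
-- is a uniform gap. The summand `0ℚ` is the term of `0ℝ` in the unfolded `0ℝ < x`.
p≥2η⇒q≥η : ∀ p q {η} → η ℚ.+ η ℚ.≤ p → dist p q ℚ.< η → 0ℚ ℚ.+ η ℚ.≤ q
p≥2η⇒q≥η p q {η} 2η≤p d<η = begin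
  0ℚ ℚ.+ η                       ≡⟨ solve 1 (λ h → con 0ℚ :+ h := (h :+ h) :- h) ≡.refl η ⟩
  (η ℚ.+ η) ℚ.- η                ≤⟨ ℚₚ.+-monoˡ-≤ (ℚ.- η) 2η≤p ⟩
  p ℚ.- η                        ≤⟨ ℚₚ.+-monoˡ-≤ (ℚ.- η) (≤+dist p q) ⟩
  (q ℚ.+ dist p q) ℚ.- η         ≤⟨ ℚₚ.+-monoˡ-≤ (ℚ.- η) (ℚₚ.+-monoʳ-≤ q (ℚₚ.<⇒≤ d<η)) ⟩
  (q ℚ.+ η) ℚ.- η                ≡⟨ solve 2 (λ a h → (a :+ h) :- h := a) ≡.refl q η ⟩
  q                              ∎
  where open ℚₚ.≤-Reasoning

-- The complementary case: a term below `δ` keeps all later terms below `δ + η`, rounded up to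
-- `δ + δ`.
p<δ⇒q≤2δ : ∀ p q {η δ} → 0ℚ ℚ.< η → η ℚ.+ η ≡ δ → p ℚ.< δ → dist q p ℚ.< η → q ℚ.≤ δ ℚ.+ δ
p<δ⇒q≤2δ p q {η} {δ} 0<η 2η≡δ p<δ d<η = begin
  q                  ≤⟨ ≤+dist q p ⟩
  p ℚ.+ dist q p     ≤⟨ ℚₚ.+-mono-≤ (ℚₚ.<⇒≤ p<δ) (ℚₚ.<⇒≤ (ℚₚ.<-trans d<η (half< 0<η))) ⟩
  δ ℚ.+ (η ℚ.+ η)    ≡⟨ ≡.cong (δ ℚ.+_) 2η≡δ ⟩
  δ ℚ.+ δ            ∎
  where open ℚₚ.≤-Reasoning

-- Deciding a rational inequality at one late index settles the limit up to ε.
≮0⇒≤0 : ∀ {x} → ¬ (0ℝ < x) → x ≤ 0ℝ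
≮0⇒≤0 {x} 0≮x = mk≤ λ ε 0<ε →
  let δ , 0<δ , 2δ≡ε = halve ε 0<ε
      η , 0<η , 2η≡δ = halve δ 0<δ
      N , close = cauchy x η 0<η
  in case (η ℚ.+ η) ℚₚ.≤? seq x N of λ where
    (yes 2η≤xN) → contradiction
      (η , 0<η , N , λ n N≤n → p≥2η⇒q≥η (seq x N) (seq x n) 2η≤xN (close N n ℕₚ.≤-refl N≤n)) 0≮x
    (no 2η≰xN) → N , λ n N≤n → subst (seq x n ℚ.≤_)
      (≡.trans 2δ≡ε (≡.sym (ℚₚ.+-identityˡ ε)))
      (p<δ⇒q≤2δ (seq x N) (seq x n) 0<η 2η≡δ (subst (seq x N ℚ.<_) 2η≡δ (ℚₚ.≰⇒> 2η≰xN))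
        (close n N N≤n ℕₚ.≤-refl))

neg-antimono-≤ : ∀ {x y} → x ≤ y → - y ≤ - x
neg-antimono-≤ {x} {y} x≤y = mk≤ λ ε 0<ε → map-eventually
  (λ n p → begin
    ℚ.- seq y n                  ≡⟨ solve 2 (λ b e → :- b := :- (b :+ e) :+ e) ≡.refl (seq y n) ε ⟩
    ℚ.- (seq y n ℚ.+ ε) ℚ.+ ε    ≤⟨ ℚₚ.+-monoˡ-≤ ε (ℚₚ.neg-antimono-≤ p) ⟩
    ℚ.- seq x n ℚ.+ ε            ∎)
  (within x≤y ε 0<ε)
  where open ℚₚ.≤-Reasoning

x≤∣x∣ : ∀ x → x ≤ ∣ x ∣
x≤∣x∣ x = pointwise⇒≤ λ n → p≤∣p∣ (seq x n)

0≤∣x∣ : ∀ x → 0ℝ ≤ ∣ x ∣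
0≤∣x∣ x = pointwise⇒≤ λ n → ℚₚ.0≤∣p∣ (seq x n)

∣x∣≤y : ∀ {x y} → x ≤ y → - x ≤ y → ∣ x ∣ ≤ y
∣x∣≤y x≤y -x≤y = mk≤ λ ε 0<ε →
  zip-eventually (λ n → ∣∣-lub) (within x≤y ε 0<ε) (within -x≤y ε 0<ε)

0≤x⇒∣x∣≈x : ∀ {x} → 0ℝ ≤ x → ∣ x ∣ ≈ x
0≤x⇒∣x∣≈x {x} 0≤x = ≤-antisym
  (∣x∣≤y ≤-refl (≤-trans (neg-antimono-≤ 0≤x) (≤-trans -0≤0 0≤x)))
  (x≤∣x∣ x)
  where
  -0≤0 : - 0ℝ ≤ 0ℝ
  -0≤0 = pointwise⇒≤ λ n → ℚₚ.≤-refl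

x≤0⇒∣x∣≈-x : ∀ {x} → x ≤ 0ℝ → ∣ x ∣ ≈ - x
x≤0⇒∣x∣≈-x {x} x≤0 = ≈-trans {∣ x ∣} {∣ - x ∣} { - x}
  (≗⇒≈ ∣ x ∣ ∣ - x ∣ λ n → ≡.sym (ℚₚ.∣-p∣≡∣p∣ (seq x n)))
  (0≤x⇒∣x∣≈x (≤-trans 0≤-0 (neg-antimono-≤ x≤0)))
  where
  0≤-0 : 0ℝ ≤ - 0ℝ
  0≤-0 = pointwise⇒≤ λ n → ℚₚ.≤-refl

x≤x+y : ∀ {x y} → 0ℝ ≤ y → x ≤ x + y
x≤x+y {x} 0≤y = ≤-trans
  (pointwise⇒≤ λ n → ℚₚ.≤-reflexive (≡.sym (ℚₚ.+-identityʳ (seq x n))))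
  (+-mono-≤ (≤-refl {x}) 0≤y)

⊔-lub : ∀ {x y z} → x ≤ z → y ≤ z → x ⊔ y ≤ z
⊔-lub x≤z y≤z = mk≤ λ ε 0<ε →
  zip-eventually (λ n → ℚₚ.⊔-lub) (within x≤z ε 0<ε) (within y≤z ε 0<ε)

-- The fold starts at `0ℝ`, so an upper bound has to be nonnegative as well.
maximum-lub : ∀ {n} (f : Fin n → ℝ) {z} → 0ℝ ≤ z → (∀ j → f j ≤ z) → Vector.foldr _⊔_ 0ℝ f ≤ z
maximum-lub {zero}  f 0≤z f≤z = 0≤z
maximum-lub {suc n} f 0≤z f≤z = ⊔-lub (f≤z zero) (maximum-lub (f ∘ suc) 0≤z (f≤z ∘ suc))

f≤maximum : ∀ {n} (f : Fin n → ℝ) j → f j ≤ Vector.foldr _⊔_ 0ℝ f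
f≤maximum {suc n} f zero    = pointwise⇒≤ λ k → ℚₚ.p≤p⊔q (seq (f zero) k) _
f≤maximum {suc n} f (suc j) = ≤-trans (f≤maximum (f ∘ suc) j)
  (pointwise⇒≤ λ k → ℚₚ.p≤q⊔p (seq (f zero) k) _)

-- Degrees of polynomials and determinants

module PolynomialDegrees (R : CommutativeRing 0ℓ 0ℓ) where
  private module R = CommutativeRing R
  open Polynomial R.rawRing
  open Determinant rawRing
  open RawSemiringDefs (RawRing.rawSemiring rawRing) using (sum; product; _^_)
  open RawSemiringDefs (RawRing.rawSemiring R.rawRing) using () renaming (sum to sumᴿ)
  open SetoidReasoning R.setoid

  coeff-+ : ∀ p q k → coeff (p +ₚ q) k R.≈ coeff p k R.+ coeff q k
  coeff-+ []      q       k       = R.sym (R.+-identityˡ _)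
  coeff-+ (a ∷ p) []      k       = R.sym (R.+-identityʳ _)
  coeff-+ (a ∷ p) (b ∷ q) zero    = R.refl
  coeff-+ (a ∷ p) (b ∷ q) (suc k) = coeff-+ p q k

  coeff-scale : ∀ a q k → coeff (map (a R.*_) q) k R.≈ a R.* coeff q k
  coeff-scale a []      k       = R.sym (R.zeroʳ a)
  coeff-scale a (b ∷ q) zero    = R.refl
  coeff-scale a (b ∷ q) (suc k) = coeff-scale a q k

  coeff-∷* : ∀ a p q k →
             coeff ((a ∷ p) *ₚ q) k R.≈ a R.* coeff q k R.+ coeff (R.0# ∷ (p *ₚ q)) k
  coeff-∷* a p q k = R.trans (coeff-+ (map (a R.*_) q) _ k) (R.+-congʳ (coeff-scale a q k))

  -- Trailing zeros are allowed and equality with zero need not be decidable, so only upper bounds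
  -- are tracked. The strict bound lets `DegreeBelow 0` describe the zero polynomial.
  record DegreeBelow (d : ℕ) (p : Poly) : Set where
    constructor degree<
    field
      vanishes : ∀ k → d ℕ.≤ k → coeff p k R.≈ R.0#

  open DegreeBelow

  weaken : ∀ {d e p} → d ℕ.≤ e → DegreeBelow d p → DegreeBelow e p
  weaken d≤e h = degree< λ k e≤k → vanishes h k (ℕₚ.≤-trans d≤e e≤k)

  []-degree : ∀ {d} → DegreeBelow d []
  []-degree = degree< λ _ _ → R.refl

  const-degree : ∀ a → DegreeBelow 1 (const a)
  const-degree a = degree< λ { (suc k) _ → R.refl }

  linear-degree : ∀ a b → DegreeBelow 2 (a ∷ b ∷ [])
  linear-degree a b = degree< λ { (suc (suc k)) _ → R.refl ; (suc zero) (s≤s ()) }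

  tail-degree : ∀ {d a p} → DegreeBelow (suc d) (a ∷ p) → DegreeBelow d p
  tail-degree h = degree< λ k d≤k → vanishes h (suc k) (s≤s d≤k)

  shift-degree : ∀ {d p} → DegreeBelow d p → DegreeBelow (suc d) (R.0# ∷ p)
  shift-degree h = degree< λ { (suc k) (s≤s d≤k) → vanishes h k d≤k }

  shift-zero : ∀ {p} → DegreeBelow 0 p → DegreeBelow 0 (R.0# ∷ p)
  shift-zero h = degree< λ { zero _ → R.refl ; (suc k) _ → vanishes h k z≤n }

  +-degree : ∀ {d p q} → DegreeBelow d p → DegreeBelow d q → DegreeBelow d (p +ₚ q)
  +-degree {p = p} {q} hp hq = degree< λ k d≤k → R.trans (coeff-+ p q k)
    (R.trans (R.+-cong (vanishes hp k d≤k) (vanishes hq k d≤k)) (R.+-identityˡ R.0#))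

  scale-degree : ∀ {d} a {q} → DegreeBelow d q → DegreeBelow d (map (a R.*_) q)
  scale-degree a {q} h = degree< λ k d≤k →
    R.trans (coeff-scale a q k) (R.trans (R.*-congˡ (vanishes h k d≤k)) (R.zeroʳ a))

  -- A list representing the zero polynomial may be nonempty, so its products do not simply compute
  -- to `[]`.
  zero-* : ∀ {p} q → DegreeBelow 0 p → DegreeBelow 0 (p *ₚ q)
  zero-* {[]}    q h = []-degree
  zero-* {a ∷ p} q h = +-degree
    (degree< λ k _ → R.trans (coeff-scale a q k)
      (R.trans (R.*-congʳ (vanishes h 0 z≤n)) (R.zeroˡ _)))
    (shift-zero (zero-* {p} q (degree< λ k _ → vanishes h (suc k) z≤n)))

  -- Degree at most `d` times degree below `e` stays below `d + e`; the asymmetric bounds avoid a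
  -- predecessor.
  *-degree : ∀ {d e p q} → DegreeBelow (suc d) p → DegreeBelow e q → DegreeBelow (d ℕ.+ e) (p *ₚ q)
  *-degree         {p = []}        hp hq = []-degree
  -- Here the tail of the first factor is the zero polynomial, so only the scalar multiple of `q`
  -- counts.
  *-degree {zero}  {p = a ∷ p} {q} hp hq = +-degree (scale-degree a hq)
    (weaken z≤n (shift-zero (zero-* q (tail-degree hp))))
  *-degree {suc d} {e} {a ∷ p} {q} hp hq = +-degree
    (weaken (ℕₚ.m≤n+m e (suc d)) (scale-degree a hq))
    (shift-degree (*-degree (tail-degree hp) hq))

  sum-degree : ∀ {d n} (t : Fin n → Poly) → (∀ j → DegreeBelow d (t j)) → DegreeBelow d (sum t)
  sum-degree {n = zero}  t h = []-degree
  sum-degree {n = suc n} t h = +-degree (h zero) (sum-degree (t ∘ suc) (h ∘ suc))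

  sign-degree : ∀ n → DegreeBelow 1 (map (R.-_) (const R.1#) ^ n)
  sign-degree zero    = const-degree R.1#
  sign-degree (suc n) = *-degree (const-degree (R.- R.1#)) (sign-degree n)

  -- This is the summand in the definition of `det`, named so that degree bounds can be stated for
  -- single terms.
  laplaceTerm : ∀ {n} → SquareMatrix Poly (suc n) → Fin (suc n) → Poly
  laplaceTerm A j = (map (R.-_) (const R.1#) ^ toℕ j) *ₚ
    (A zero j *ₚ det (λ k l → A (suc k) (punchIn j l)))

  laplaceTerm-degree : ∀ {d e n} (A : SquareMatrix Poly (suc n)) j → DegreeBelow (suc d) (A zero j) →
    DegreeBelow e (det λ k l → A (suc k) (punchIn j l)) → DegreeBelow (d ℕ.+ e) (laplaceTerm A j)
  laplaceTerm-degree A j hA hdet = *-degree (sign-degree (toℕ j)) (*-degree hA hdet)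

  -- Each row of linear entries raises the degree by at most one.
  det-degree : ∀ {n} (A : SquareMatrix Poly n) → (∀ k l → DegreeBelow 2 (A k l)) →
               DegreeBelow (suc n) (det A)
  det-degree {zero}  A h = const-degree R.1#
  det-degree {suc n} A h = sum-degree (laplaceTerm A) λ j → laplaceTerm-degree A j (h zero j)
    (det-degree _ λ k l → h (suc k) (punchIn j l))

  -- A constant row raises the degree by nothing, which saves one. It is either the row being
  -- expanded or a row that survives in every minor.
  det-degree-constantRow : ∀ {n} (A : SquareMatrix Poly n) → (∀ k l → DegreeBelow 2 (A k l)) →
    ∀ i → (∀ l → DegreeBelow 1 (A i l)) → DegreeBelow n (det A)
  det-degree-constantRow {suc n} A h zero    hᵢ = sum-degree (laplaceTerm A) λ j →
    laplaceTerm-degree A j (hᵢ j) (det-degree _ λ k l → h (suc k) (punchIn j l))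
  det-degree-constantRow {suc n} A h (suc i) hᵢ = sum-degree (laplaceTerm A) λ j →
    laplaceTerm-degree A j (h zero j)
      (det-degree-constantRow _ (λ k l → h (suc k) (punchIn j l)) i (λ l → hᵢ (punchIn j l)))

  -- p = Xⁿ + s Xⁿ⁻¹ + …; the shift by 0# makes s the (vacuous) coefficient 0# when n = 0.
  record MonicWithSecond (n : ℕ) (s : R.Carrier) (p : Poly) : Set where
    field
      degree  : DegreeBelow (suc n) p
      leading : coeff p n R.≈ R.1#
      second  : coeff (R.0# ∷ p) n R.≈ s

  open MonicWithSecond

  one-monic : MonicWithSecond 0 R.0# (const R.1#)
  one-monic = record { degree = const-degree R.1# ; leading = R.refl ; second = R.refl }

  one-* : ∀ q k → coeff (const R.1# *ₚ q) k R.≈ coeff q k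
  one-* q k = begin
    coeff (const R.1# *ₚ q) k                       ≈⟨ coeff-∷* R.1# [] q k ⟩
    R.1# R.* coeff q k R.+ coeff (R.0# ∷ []) k      ≈⟨ R.+-cong (R.*-identityˡ _) (vanishes (shift-zero []-degree) k z≤n) ⟩
    coeff q k R.+ R.0#                              ≈⟨ R.+-identityʳ _ ⟩
    coeff q k                                       ∎

  coeff-linear-* : ∀ a q k →
    coeff ((a ∷ R.1# ∷ []) *ₚ q) (suc k) R.≈ a R.* coeff q (suc k) R.+ coeff q k
  coeff-linear-* a q k = R.trans (coeff-∷* a (const R.1#) q (suc k)) (R.+-congˡ (one-* q k))

  -- In `(X + a)(Xⁿ + s Xⁿ⁻¹ + …)` the coefficient of `Xⁿ` gets `a` from the leading term and `s`
  -- from the shifted second one.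
  linear-*-monic : ∀ {n s q} a → MonicWithSecond n s q →
                   MonicWithSecond (suc n) (a R.+ s) ((a ∷ R.1# ∷ []) *ₚ q)
  linear-*-monic {n} {s} {q} a m = record
    { degree  = *-degree (linear-degree a R.1#) (degree m)
    ; leading = begin
        coeff ((a ∷ R.1# ∷ []) *ₚ q) (suc n)       ≈⟨ coeff-linear-* a q n ⟩
        a R.* coeff q (suc n) R.+ coeff q n        ≈⟨ R.+-cong (R.*-congˡ (vanishes (degree m) (suc n) ℕₚ.≤-refl)) (leading m) ⟩
        a R.* R.0# R.+ R.1#                        ≈⟨ R.+-congʳ (R.zeroʳ a) ⟩
        R.0# R.+ R.1#                              ≈⟨ R.+-identityˡ _ ⟩
        R.1#                                       ∎
    ; second  = begin
        coeff ((a ∷ R.1# ∷ []) *ₚ q) n             ≈⟨ split n ⟩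
        a R.* coeff q n R.+ coeff (R.0# ∷ q) n     ≈⟨ R.+-cong (R.*-congˡ (leading m)) (second m) ⟩
        a R.* R.1# R.+ s                           ≈⟨ R.+-congʳ (R.*-identityʳ a) ⟩
        a R.+ s                                    ∎
    }
    where
    -- `coeff-linear-*` covers positive indices only; at index zero the shifted list supplies the
    -- missing zero.
    split : ∀ k → coeff ((a ∷ R.1# ∷ []) *ₚ q) k R.≈ a R.* coeff q k R.+ coeff (R.0# ∷ q) k
    split zero    = coeff-∷* a (const R.1#) q zero
    split (suc k) = coeff-linear-* a q k

  -- A summand of degree below `n` reaches neither of the two top coefficients. It will be the sum
  -- of the off-diagonal Laplace terms.
  +-monic : ∀ {n s p q} → MonicWithSecond (suc n) s p → DegreeBelow n q →
            MonicWithSecond (suc n) s (p +ₚ q)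
  +-monic {n} {s} {p} {q} m hq = record
    { degree  = +-degree (degree m) (weaken (ℕₚ.m≤n⇒m≤1+n (ℕₚ.n≤1+n n)) hq)
    ; leading = absorb (suc n) (ℕₚ.n≤1+n n) (leading m)
    ; second  = absorb n ℕₚ.≤-refl (second m)
    }
    where
    absorb : ∀ k {c} → n ℕ.≤ k → coeff p k R.≈ c → coeff (p +ₚ q) k R.≈ c
    absorb k n≤k eq = R.trans (coeff-+ p q k) (R.trans (R.+-cong eq (vanishes hq k n≤k)) (R.+-identityʳ _))

  -- The sign of the first Laplace term is an empty power, leaving a factor `const R.1#` to be
  -- cleared.
  one-*-monic : ∀ {n s q} → MonicWithSecond n s q → MonicWithSecond n s (const R.1# *ₚ q)
  one-*-monic {n} {s} {q} m = record
    { degree  = degree< λ k n<k → R.trans (one-* q k) (vanishes (degree m) k n<k)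
    ; leading = R.trans (one-* q n) (leading m)
    ; second  = R.trans (shifted n) (second m)
    }
    where
    shifted : ∀ k → coeff (R.0# ∷ (const R.1# *ₚ q)) k R.≈ coeff (R.0# ∷ q) k
    shifted zero    = R.refl
    shifted (suc k) = one-* q k

  -- Vieta's formula for the second coefficient, one linear factor at a time.
  product-monic : ∀ {n} (as : Fin n → R.Carrier) →
    MonicWithSecond n (sumᴿ as) (product λ i → as i ∷ R.1# ∷ [])
  product-monic {zero}  as = one-monic
  product-monic {suc n} as = linear-*-monic (as zero) (product-monic (as ∘ suc))

  -- A term of the Laplace expansion off the diagonal leaves a minor with a
  -- constant row, so it does not reach degree n.
  det-monic : ∀ {n} (A : SquareMatrix Poly n) (as : Fin n → R.Carrier) →
    (∀ i → A i i ≡ as i ∷ R.1# ∷ []) → (∀ i j → i ≢ j → DegreeBelow 1 (A i j)) →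
    (∀ i j → DegreeBelow 2 (A i j)) → MonicWithSecond n (sumᴿ as) (det A)
  det-monic {zero}  A as hdiag hoff hall = one-monic
  det-monic {suc n} A as hdiag hoff hall = +-monic {p = laplaceTerm A zero}
    (one-*-monic (≡.subst (λ p → MonicWithSecond (suc n) (sumᴿ as) (p *ₚ det minor)) (≡.sym (hdiag zero))
      (linear-*-monic (as zero) (det-monic minor (as ∘ suc) (hdiag ∘ suc)
        (λ i j i≢j → hoff (suc i) (suc j) (i≢j ∘ suc-injective)) (λ i j → hall (suc i) (suc j))))))
    (sum-degree (laplaceTerm A ∘ suc) λ j → laplaceTerm-degree A (suc j) (hoff zero (suc j) 0≢1+n)
      -- Row `suc j` lost its only nonconstant entry with column `suc j`; in the minor it has index
      -- `j`.
      (det-degree-constantRow _ (λ k l → hall (suc k) (punchIn (suc j) l)) j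
        (λ l → hoff (suc j) (punchIn (suc j) l) (punchInᵢ≢i (suc j) l ∘ ≡.sym))))
    where
    minor : SquareMatrix Poly n
    minor k l = A (suc k) (suc l)

-- Sums and eigenvalues

module BalancedSums (R : CommutativeRing 0ℓ 0ℓ) where
  private module R = CommutativeRing R
  open Sum R.+-commutativeMonoid
  open import Algebra.Properties.Group R.+-group using (inverseˡ-unique; ⁻¹-injective)
  open SetoidReasoning R.setoid

  sum-zero : ∀ {n} (f : Fin n → R.Carrier) → (∀ k → f k R.≈ R.0#) → sum f R.≈ R.0#
  sum-zero {n} f f≈0 = R.trans (sum-cong-≋ f≈0) (sum-replicate-zero n)

  sum-opposite : ∀ {n} (f g : Fin n → R.Carrier) → (∀ k → g k R.≈ R.- f k) → sum g R.≈ R.- sum f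
  sum-opposite f g g≈-f = inverseˡ-unique (sum g) (sum f) (begin
    sum g R.+ sum f             ≈⟨ ∑-distrib-+ g f ⟨
    sum (λ k → g k R.+ f k)     ≈⟨ sum-zero _ (λ k → R.trans (R.+-congʳ (g≈-f k)) (R.-‿inverseˡ (f k))) ⟩
    R.0#                        ∎)

  -- The summands are the constant coefficients of `X +ₚ const (- a)`, where the zero of `X` remains
  -- after unfolding.
  sum-injective-neg : ∀ {n} (f g : Fin n → R.Carrier) →
    sum (λ k → R.0# R.+ R.- f k) R.≈ sum (λ k → R.0# R.+ R.- g k) → sum f R.≈ sum g
  sum-injective-neg f g eq = ⁻¹-injective (begin
    R.- sum f                         ≈⟨ sum-opposite f _ (λ k → R.+-identityˡ _) ⟨
    sum (λ k → R.0# R.+ R.- f k)      ≈⟨ eq ⟩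
    sum (λ k → R.0# R.+ R.- g k)      ≈⟨ sum-opposite g _ (λ k → R.+-identityˡ _) ⟩
    R.- sum g                         ∎)

  -- In the application `f` lists the eigenvalues, `g` their absolute values, and `i` is the
  -- position of the positive one.
  module _ {n} (f g : Fin (suc n) → R.Carrier) (i : Fin (suc n)) (∑f≈0 : sum f R.≈ R.0#)
           (g≈-f : ∀ k → g (punchIn i k) R.≈ R.- f (punchIn i k)) where

    -- Since `f` sums to zero, its other terms add up to the negative of `f i`, and `g` negates
    -- them.
    sum-others : sum (removeAt g i) R.≈ f i
    sum-others = begin
      sum (removeAt g i)        ≈⟨ sum-opposite (removeAt f i) (removeAt g i) g≈-f ⟩
      R.- sum (removeAt f i)    ≈⟨ inverseˡ-unique _ _ (R.trans (R.sym (sum-remove f)) ∑f≈0) ⟨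
      f i                       ∎

    sum-twice : g i R.≈ f i → sum g R.≈ f i R.+ f i
    sum-twice gᵢ≈fᵢ = R.trans (sum-remove g) (R.+-cong gᵢ≈fᵢ sum-others)

-- Eigenvalue sum and trace

open PolynomialDegrees ℝ-commutativeRing
open BalancedSums ℝ-commutativeRing
open Sum ℝ-ring.+-commutativeMonoid using (sum)

charMatrix-diagonal : ∀ {n} (A : SquareMatrix ℝ n) i →
  charMatrix A i i ≡ (0ℝ + - A i i) ∷ 1ℝ ∷ []
charMatrix-diagonal A i with i ≟ i
... | yes _  = ≡.refl
... | no i≢i = contradiction ≡.refl i≢i

charMatrix-offDiagonal : ∀ {n} (A : SquareMatrix ℝ n) i j → i ≢ j → DegreeBelow 1 (charMatrix A i j)
charMatrix-offDiagonal A i j i≢j with i ≟ j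
... | yes i≡j = contradiction i≡j i≢j
... | no _    = const-degree _

charMatrix-degree : ∀ {n} (A : SquareMatrix ℝ n) i j → DegreeBelow 2 (charMatrix A i j)
charMatrix-degree A i j with i ≟ j
... | yes _ = linear-degree _ _
... | no _  = weaken (s≤s z≤n) (const-degree _)

sum-eigenvalues : ∀ {n} (A : SquareMatrix ℝ n) λs → IsSpectrum A λs → sum λs ≈ sum (λ i → A i i)
sum-eigenvalues {zero}  A λs spec = ℝ-ring.refl {0ℝ}
sum-eigenvalues {suc n} A λs spec = sum-injective-neg λs (λ i → A i i) (begin
  -- The polynomials have degree `suc n`, so their second coefficient sits at index `n`.
  sum (λ i → 0ℝ + - λs i)       ≈⟨ second (product-monic (λ i → 0ℝ + - λs i)) ⟨
  ℝ[X].coeff (monicWithRoots λs) n   ≈⟨ spec n ⟨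
  ℝ[X].coeff (charPoly A) n          ≈⟨ second (det-monic (charMatrix A) (λ i → 0ℝ + - A i i)
      (charMatrix-diagonal A) (charMatrix-offDiagonal A) (charMatrix-degree A)) ⟩
  sum (λ i → 0ℝ + - A i i)      ∎)
  where
  open SetoidReasoning ℝ-ring.setoid
  open MonicWithSecond

pathMatrix-diagonal : ∀ {n} (M : Graph n) i → pathMatrix M i i ≡ 0ℝ
pathMatrix-diagonal M i with i ≟ i
... | yes _  = ≡.refl
... | no i≢i = contradiction ≡.refl i≢i

-- Domination by the positive eigenvalue

0≤sum : ∀ {n} (f : Fin n → ℝ) → (∀ k → 0ℝ ≤ f k) → 0ℝ ≤ sum f
0≤sum {zero}  f 0≤f = ≤-refl
0≤sum {suc n} f 0≤f = ≤-trans (0≤f zero) (x≤x+y (0≤sum (f ∘ suc) (0≤f ∘ suc)))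

f≤sum : ∀ {n} (f : Fin n → ℝ) → (∀ k → 0ℝ ≤ f k) → ∀ k → f k ≤ sum f
f≤sum f 0≤f zero    = x≤x+y (0≤sum (f ∘ suc) (0≤f ∘ suc))
f≤sum f 0≤f (suc k) = ≤-trans (f≤sum (f ∘ suc) (0≤f ∘ suc) k)
  (≤-trans (x≤x+y (0≤f zero)) (≈⇒≤ (ℝ-ring.+-comm (sum (f ∘ suc)) (f zero))))

proposition1p7 : (p : ℕ) (M : Graph p) → Connected M →
    (λs : Fin p → ℝ) → IsSpectrum (pathMatrix M) λs →
    (i : Fin p) → 0ℝ < λs i → (∀ j → 0ℝ < λs j → j ≡ i) →
    (λs i ≈ spectralRadius λs) × (energy λs ≈ fromℕ 2 * spectralRadius λs)
proposition1p7 (suc n) M _ λs spec i 0<λᵢ unique = λᵢ≈ρ , (begin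
  energy λs                      ≈⟨ sum-twice λs (∣_∣ ∘ λs) i ∑λ≈0 ∣λ∣≈-λ ∣λᵢ∣≈λᵢ ⟩
  λs i + λs i                    ≈⟨ +-cong {λs i} {ρ} {λs i} {ρ} λᵢ≈ρ λᵢ≈ρ ⟩
  ρ + ρ                          ≈⟨ ≗⇒≈ (ρ + ρ) (fromℕ 2 * ρ) (λ k → double (seq ρ k)) ⟩
  fromℕ 2 * ρ                    ∎)
  where
  open SetoidReasoning ℝ-ring.setoid

  ρ = spectralRadius λs

  double : ∀ q → q ℚ.+ q ≡ (ℤ.+ 2 ℚ./ 1) ℚ.* q
  double q = solve 1 (λ q → q :+ q := con (ℤ.+ 2 ℚ./ 1) :* q) ≡.refl q

  0≤λᵢ : 0ℝ ≤ λs i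
  0≤λᵢ = <⇒≤ 0<λᵢ

  ∣λᵢ∣≈λᵢ : ∣ λs i ∣ ≈ λs i
  ∣λᵢ∣≈λᵢ = 0≤x⇒∣x∣≈x 0≤λᵢ

  -- A positive eigenvalue here would have to sit at position `i`, which `punchIn i` avoids.
  ∣λ∣≈-λ : ∀ k → ∣ λs (punchIn i k) ∣ ≈ - λs (punchIn i k)
  ∣λ∣≈-λ k = x≤0⇒∣x∣≈-x {λs (punchIn i k)} (≮0⇒≤0 λ 0<λ → punchInᵢ≢i i k (unique (punchIn i k) 0<λ))

  ∑λ≈0 : sum λs ≈ 0ℝ
  ∑λ≈0 = begin
    sum λs                         ≈⟨ sum-eigenvalues (pathMatrix M) λs spec ⟩
    sum (λ j → pathMatrix M j j)
      ≈⟨ sum-zero (λ j → pathMatrix M j j) (λ j →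
           ℝ-ring.reflexive (pathMatrix-diagonal M j)) ⟩
    0ℝ                             ∎

  ∣λ∣≤λᵢ : ∀ j → ∣ λs j ∣ ≤ λs i
  ∣λ∣≤λᵢ j with i ≟ j
  ... | yes ≡.refl = ≈⇒≤ ∣λᵢ∣≈λᵢ
  -- The absolute value at `j` is one term of a nonnegative sum over the positions other than `i`,
  -- and that sum equals `λs i`.
  ... | no i≢j = subst (λ j → ∣ λs j ∣ ≤ λs i) (punchIn-punchOut i≢j) (≤-trans
    (f≤sum (removeAt (∣_∣ ∘ λs) i) (λ k → 0≤∣x∣ (λs (punchIn i k))) (punchOut i≢j))
    (≈⇒≤ (sum-others λs (∣_∣ ∘ λs) i ∑λ≈0 ∣λ∣≈-λ)))

  λᵢ≈ρ : λs i ≈ ρ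
  λᵢ≈ρ = ≤-antisym (≤-trans (x≤∣x∣ (λs i)) (f≤maximum (∣_∣ ∘ λs) i))
                   (maximum-lub (∣_∣ ∘ λs) 0≤λᵢ ∣λ∣≤λᵢ)
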